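{- Define integers $b(n,k)$, for integers $n\ge 1$ and $k\le n+1$, recursively by $$b(n,k)=\begin{cases} 0 & k<2,\\ 1 & k=2 \text{ and } n\in\{1,2\},\\ 2 & n=2 \text{ and } k=3,\\ 2b(n-1,k-1)+\displaystyle\sum_{j=k-1}^{n-1}b(n-2,j) & \text{otherwise}, \end{cases}$$ where a sum whose lower limit exceeds its upper limit is $0$. Then for every integer $n\ge 1$, $$\mathrm{pf}_n(123,132)=\sum_{k=2}^{n+1}b(n,k).$$
   Context: A Dyck path of semilength $n$ is a lattice path from $(0,0)$ to $(n,n)$ consisting of $n$ north steps $N=(0,1)$ and $n$ east steps $E=(1,0)$ that never goes below the line $y=x$. A parking function of size $n$ is a Dyck path of semilength $n$ whose $n$ north steps are labeled bijectively by $\{1,\dots,n\}$ so that whenever two north steps are consecutive in the path (one immediately following the other), the label of the later one is larger. For a parking function $p$ of size $n$, $\phi(p)$ is the permutation of $\{1,\dots,n\}$ (in one-line notation) obtained by reading the labels of the north steps in the order they occur along the path. A permutation $\pi$ of $\{1,\dots,n\}$ contains a permutation $\rho$ of $\{1,\dots,m\}$ if there are indices $1\le i_1<\cdots<i_m\le n$ such that $\pi_{i_a}\le\pi_{i_b}$ if and only if $\rho_a\le\rho_b$; otherwise $\pi$ avoids $\rho$. For permutations $\rho_1,\dots,\rho_r$, $\mathrm{pf}_n(\rho_1,\dots,\rho_r)$ denotes the number of parking functions $p$ of size $n$ such that $\phi(p)$ avoids each of $\rho_1,\dots,\rho_r$. -}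

module Defs where

open import Data.Fin.Base as Fin using (Fin)
open import Data.Fin.Patterns using (0F; 1F; 2F)
import Data.Fin.Properties as Fin
open import Data.Fin.Permutation using (Permutation′; _⟨$⟩ʳ_)
open import Data.List.Base using (List; []; _∷_; _++_; map; length; filter;
  mapMaybe; allFin; applyUpTo; cartesianProduct; cartesianProductWith)
open import Data.List.Membership.Propositional using (_∈_)
open import Data.List.Membership.Propositional.Properties using (∈-map⁺; ∈-map⁻;
  ∈-++⁺ˡ; ∈-++⁺ʳ; ∈-allFin; ∈-cartesianProductWith⁺; ∈-cartesianProduct⁺; ∈-filter⁺)
open import Data.List.Relation.Unary.All using (All; all?)
open import Data.List.Relation.Unary.AllPairs using ([]; _∷_)
open import Data.List.Relation.Unary.Any using (here)
import Data.List.Relation.Unary.All as All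
open import Data.List.Relation.Unary.Unique.Propositional using (Unique)
import Data.List.Relation.Unary.Unique.Propositional.Properties as Unique
import Data.Maybe.Base as Maybe
open import Data.Nat.Base using (ℕ; zero; suc; _+_; _*_; _∸_; _≤_)
open import Data.Nat.ListAction using (sum)
import Data.Nat.Properties as ℕ
open import Data.Product.Base using (Σ; ∃; ∃-syntax; _×_; _,_; proj₁; proj₂; uncurry)
open import Data.Unit.Base using (⊤; tt)
open import Data.Vec.Base using (Vec; []; _∷_; lookup)
import Data.Vec.Properties as Vec
import Data.Vec.Functional as F
open import Function.Base using (_∘_)
open import Function.Bundles using (_⇔_; mk⇔; mk⤖; Equivalence)
open import Function.Definitions using (Injective; Surjective; Bijective)
open import Function.Properties.Bijection using (⤖⇒↔)
open import Relation.Binary.Core using (_Preserves_⟶_)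
open import Relation.Binary.PropositionalEquality
  using (_≡_; _≗_; refl; sym; cong; subst; subst₂)
open import Relation.Nullary using (¬_; Dec; yes; no)
open import Relation.Nullary.Decidable using (True; toWitness; map′; dec⇒maybe;
  _×-dec_; _→-dec_; ¬?)
open import Relation.Unary using (Decidable)

private
  variable
    m n x y : ℕ

-- Path x y: lattice paths with x east and y north steps, i.e. from
-- (0,0) to (x,y).
infixr 5 E∷_ N∷_

data Path : ℕ → ℕ → Set where
  []  : Path 0 0
  E∷_ : Path x y → Path (suc x) y
  N∷_ : Path x y → Path x (suc y)

-- When p is drawn starting at (i,j), no lattice point on it lies below
-- the line y = x.
NeverBelow : (i j : ℕ) → Path x y → Set
NeverBelow i j []     = i ≤ j
NeverBelow i j (E∷ p) = i ≤ j × NeverBelow (suc i) j p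
NeverBelow i j (N∷ p) = i ≤ j × NeverBelow i (suc j) p

IsDyck : Path n n → Set
IsDyck = NeverBelow 0 0

neverBelow? : ∀ i j (p : Path x y) → Dec (NeverBelow i j p)
neverBelow? i j []     = i ℕ.≤? j
neverBelow? i j (E∷ p) = i ℕ.≤? j ×-dec neverBelow? (suc i) j p
neverBelow? i j (N∷ p) = i ℕ.≤? j ×-dec neverBelow? i (suc j) p

-- Permutations are given in one-line notation; Fin n stands for 1, …, n.
IsBijective : Vec (Fin n) n → Set
IsBijective v = Bijective _≡_ _≡_ (lookup v)

isBijective? : (v : Vec (Fin n) n) → Dec (IsBijective v)
isBijective? v = injective? ×-dec surjective?
  where
  injective? : Dec (Injective _≡_ _≡_ (lookup v))
  injective? = map′ (λ f {i} {j} → f i j) (λ f i j → f {i} {j})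
    (Fin.all? λ i → Fin.all? λ j → (lookup v i Fin.≟ lookup v j) →-dec (i Fin.≟ j))

  surjective? : Dec (Surjective _≡_ _≡_ (lookup v))
  surjective? = map′
    (λ f j → proj₁ (f j) , λ { refl → proj₂ (f j) })
    (λ f j → proj₁ (f j) , proj₂ (f j) refl)
    (Fin.all? λ j → Fin.any? λ i → lookup v i Fin.≟ j)

toPermutation : (v : Vec (Fin n) n) → IsBijective v → Permutation′ n
toPermutation v bij = ⤖⇒↔ (mk⤖ bij)

oneLine : (v : Vec (Fin n) n) {_ : True (isBijective? v)} → Permutation′ n
oneLine v {t} = toPermutation v (toWitness t)

IsOccurrence : Permutation′ n → Permutation′ m → (Fin m → Fin n) → Set
IsOccurrence π ρ i =
  i Preserves Fin._<_ ⟶ Fin._<_ ×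
  (∀ a b → (π ⟨$⟩ʳ i a Fin.≤ π ⟨$⟩ʳ i b) ⇔ (ρ ⟨$⟩ʳ a Fin.≤ ρ ⟨$⟩ʳ b))

Contains : Permutation′ n → Permutation′ m → Set
Contains π ρ = ∃[ i ] IsOccurrence π ρ i

Avoids : Permutation′ n → Permutation′ m → Set
Avoids π ρ = ¬ Contains π ρ

AvoidsAll : Permutation′ n → List (∃ Permutation′) → Set
AvoidsAll π = All λ ρ → Avoids π (proj₂ ρ)

anyFunction? : ∀ {m n} {P : (Fin m → Fin n) → Set} →
               (∀ {f g} → f ≗ g → P f → P g) → Decidable P → Dec (∃ P)
anyFunction? {zero} resp P? =
  map′ (F.[] ,_) (λ (f , p) → resp (λ ()) p) (P? F.[])
anyFunction? {suc m} resp P? =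
  map′ (λ (k , f , p) → k F.∷ f , p)
       (λ (f , p) → F.head f , F.tail f ,
          resp (λ { Fin.zero → refl ; (Fin.suc _) → refl }) p)
       (Fin.any? λ k → anyFunction?
          (λ f≗g → resp λ { Fin.zero → refl ; (Fin.suc a) → f≗g a })
          (λ f → P? (k F.∷ f)))

isOccurrence? : (π : Permutation′ n) (ρ : Permutation′ m) → Decidable (IsOccurrence π ρ)
isOccurrence? π ρ i =
  map′ (λ f {a} {b} → f a b) (λ f a b → f {a} {b})
    (Fin.all? λ a → Fin.all? λ b → (a Fin.<? b) →-dec (i a Fin.<? i b))
  ×-dec
  Fin.all? λ a → Fin.all? λ b →
    (π ⟨$⟩ʳ i a Fin.≤? π ⟨$⟩ʳ i b) ⇔-dec (ρ ⟨$⟩ʳ a Fin.≤? ρ ⟨$⟩ʳ b)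
  where
  _⇔-dec_ : {A B : Set} → Dec A → Dec B → Dec (A ⇔ B)
  a? ⇔-dec b? = map′ (uncurry mk⇔) (λ e → Equivalence.to e , Equivalence.from e)
    ((a? →-dec b?) ×-dec (b? →-dec a?))

contains? : (π : Permutation′ n) (ρ : Permutation′ m) → Dec (Contains π ρ)
contains? π ρ = anyFunction? resp (isOccurrence? π ρ)
  where
  resp : ∀ {f g} → f ≗ g → IsOccurrence π ρ f → IsOccurrence π ρ g
  resp f≗g (mono , iso) =
    (λ {a} {b} a<b → subst₂ Fin._<_ (f≗g a) (f≗g b) (mono a<b)) ,
    (λ a b → subst₂ (λ c d → (π ⟨$⟩ʳ c Fin.≤ π ⟨$⟩ʳ d) ⇔ (ρ ⟨$⟩ʳ a Fin.≤ ρ ⟨$⟩ʳ b))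
               (f≗g a) (f≗g b) (iso a b))

avoidsAll? : (π : Permutation′ n) → Decidable (AvoidsAll π)
avoidsAll? π = all? λ ρ → ¬? (contains? π (proj₂ ρ))

-- Entry i of the label vector is the label of the i-th north step.
-- Increasing p ls: of two consecutive north steps, the later one has
-- the larger label.
Increasing : Path x y → Vec (Fin n) y → Set
Increasing []          _            = ⊤
Increasing (E∷ p)      ls           = Increasing p ls
Increasing (N∷ [])     _            = ⊤
Increasing (N∷ E∷ p)   (_ ∷ ls)     = Increasing p ls
Increasing (N∷ N∷ p)   (k ∷ l ∷ ls) = k Fin.< l × Increasing (N∷ p) (l ∷ ls)

increasing? : (p : Path x y) (ls : Vec (Fin n) y) → Dec (Increasing p ls)
increasing? []        _            = yes tt
increasing? (E∷ p)    ls           = increasing? p ls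
increasing? (N∷ [])   _            = yes tt
increasing? (N∷ E∷ p) (_ ∷ ls)     = increasing? p ls
increasing? (N∷ N∷ p) (k ∷ l ∷ ls) = (k Fin.<? l) ×-dec increasing? (N∷ p) (l ∷ ls)

LabelledPath : ℕ → Set
LabelledPath n = Path n n × Vec (Fin n) n

record IsParkingFunction {n} (c : LabelledPath n) : Set where
  constructor isParkingFunction
  field
    isDyck     : IsDyck (proj₁ c)
    bijective  : IsBijective (proj₂ c)
    increasing : Increasing (proj₁ c) (proj₂ c)

ParkingFunction : ℕ → Set
ParkingFunction n = Σ (LabelledPath n) IsParkingFunction

isParkingFunction? : Decidable (IsParkingFunction {n})
isParkingFunction? (p , ls) =
  map′ (λ (d , b , i) → isParkingFunction d b i)
       (λ (isParkingFunction d b i) → d , b , i)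
       (neverBelow? 0 0 p ×-dec isBijective? ls ×-dec increasing? p ls)

φ : ParkingFunction n → Permutation′ n
φ ((_ , ls) , pf) = toPermutation ls (IsParkingFunction.bijective pf)

paths : ∀ x y → List (Path x y)
paths zero    zero    = [] ∷ []
paths (suc x) zero    = map E∷_ (paths x zero)
paths zero    (suc y) = map N∷_ (paths zero y)
paths (suc x) (suc y) = map E∷_ (paths x (suc y)) ++ map N∷_ (paths (suc x) y)

vectors : ∀ n k → List (Vec (Fin n) k)
vectors n zero    = [] ∷ []
vectors n (suc k) = cartesianProductWith _∷_ (allFin n) (vectors n k)

labelledPaths : ∀ n → List (LabelledPath n)
labelledPaths n = cartesianProduct (paths n n) (vectors n n)

parkingFunctions : ∀ n → List (ParkingFunction n)
parkingFunctions n =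
  mapMaybe (λ c → Maybe.map (c ,_) (dec⇒maybe (isParkingFunction? c))) (labelledPaths n)

pf : ℕ → List (∃ Permutation′) → ℕ
pf n ρs = length (filter (λ p → avoidsAll? (φ p) ρs) (parkingFunctions n))

-- Two parking functions are the same when their labelled paths are, so
-- the enumeration is justified by the following facts: each labelled
-- path underlying a parking function occurs in it exactly once.

∈-paths : (p : Path x y) → p ∈ paths x y
∈-paths []                         = here refl
∈-paths {suc x} {zero}  (E∷ p)     = ∈-map⁺ E∷_ (∈-paths p)
∈-paths {suc x} {suc y} (E∷ p)     = ∈-++⁺ˡ (∈-map⁺ E∷_ (∈-paths p))
∈-paths {zero}  {suc y} (N∷ p)     = ∈-map⁺ N∷_ (∈-paths p)
∈-paths {suc x} {suc y} (N∷ p)     =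
  ∈-++⁺ʳ (map E∷_ (paths x (suc y))) (∈-map⁺ N∷_ (∈-paths p))

paths-unique : ∀ x y → Unique (paths x y)
paths-unique zero    zero    = All.[] ∷ []
paths-unique (suc x) zero    = Unique.map⁺ (λ { refl → refl }) (paths-unique x zero)
paths-unique zero    (suc y) = Unique.map⁺ (λ { refl → refl }) (paths-unique zero y)
paths-unique (suc x) (suc y) = Unique.++⁺
  (Unique.map⁺ (λ { refl → refl }) (paths-unique x (suc y)))
  (Unique.map⁺ (λ { refl → refl }) (paths-unique (suc x) y))
  λ (p∈ , p∈′) → disjoint (∈-map⁻ E∷_ p∈) (∈-map⁻ N∷_ p∈′)
  where
  disjoint : ∀ {p} → (∃ λ q → q ∈ paths x (suc y) × p ≡ E∷ q) →
             ¬ (∃ λ q → q ∈ paths (suc x) y × p ≡ N∷ q)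
  disjoint (_ , _ , refl) (_ , _ , ())

∈-vectors : ∀ {k} (v : Vec (Fin n) k) → v ∈ vectors n k
∈-vectors []      = here refl
∈-vectors (a ∷ v) = ∈-cartesianProductWith⁺ _∷_ (∈-allFin a) (∈-vectors v)

vectors-unique : ∀ n k → Unique (vectors n k)
vectors-unique n zero    = All.[] ∷ []
vectors-unique n (suc k) = Unique.cartesianProductWith⁺ _∷_ Vec.∷-injective
  (Unique.allFin⁺ n) (vectors-unique n k)

map-mapMaybe : {A : Set} {P : A → Set} (P? : Decidable P) (as : List A) →
  map proj₁ (mapMaybe (λ a → Maybe.map (a ,_) (dec⇒maybe (P? a))) as) ≡ filter P? as
map-mapMaybe P? []       = refl
map-mapMaybe P? (a ∷ as) with P? a
... | yes _ = cong (a ∷_) (map-mapMaybe P? as)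
... | no  _ = map-mapMaybe P? as

parkingFunctions-complete : (p : ParkingFunction n) →
                            proj₁ p ∈ map proj₁ (parkingFunctions n)
parkingFunctions-complete {n} ((p , ls) , isPF) =
  subst (_ ∈_) (sym (map-mapMaybe isParkingFunction? (labelledPaths n)))
    (∈-filter⁺ isParkingFunction? (∈-cartesianProduct⁺ (∈-paths p) (∈-vectors ls)) isPF)

parkingFunctions-unique : ∀ n → Unique (map proj₁ (parkingFunctions n))
parkingFunctions-unique n =
  subst Unique (sym (map-mapMaybe isParkingFunction? (labelledPaths n)))
    (Unique.filter⁺ isParkingFunction?
      (Unique.cartesianProduct⁺ (paths-unique n n) (vectors-unique n n)))

-- Σ[ j from lo to hi ] f j, both ends included; it is 0 when hi < lo.
sumFromTo : ℕ → ℕ → (ℕ → ℕ) → ℕ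
sumFromTo lo hi f = sum (map f (applyUpTo (lo +_) (suc hi ∸ lo)))

-- Outside the range 1 ≤ n, k ≤ n + 1 the value is a dummy, which neither
-- the recursion nor a sum over 2 ≤ k ≤ n + 1 refers to when started
-- inside the range.  The clause for n ≥ 3 and k ≥ 2 is written in terms
-- of n - 3 and k - 2.
b : ℕ → ℕ → ℕ
b _ 0 = 0
b _ 1 = 0
b 1 2 = 1
b 2 2 = 1
b 2 3 = 2
b (suc (suc (suc n))) (suc (suc k)) =
  2 * b (suc (suc n)) (suc k) + sumFromTo (suc k) (suc (suc n)) (b (suc n))
b _ _ = 0

123ₚ 132ₚ : ∃ Permutation′
123ₚ = 3 , oneLine (0F ∷ 1F ∷ 2F ∷ [])
132ₚ = 3 , oneLine (0F ∷ 2F ∷ 1F ∷ [])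

{-# OPTIONS --safe #-}

-- A permutation avoids 123 and 132 exactly when every entry is the largest
-- or the second largest of the entries not yet used, and an ascent is then
-- a second largest entry followed by the largest one.  A descent forces an
-- east step, so between two points where the last step is not north the
-- path makes one of the moves E, N E (with either choice of label), or
-- N N E.  If e(y,h) is the number of ways to finish from height h with y
-- north steps left, then
--   e(y,h) = e(y,h-1) + 2 e(y-1,h) + e(y-2,h+1).
-- On the other hand b(n,k) counts the avoiding parking functions whose path
-- meets the diagonal k - 1 times after the origin.  Starting at height h amounts
-- to inserting h further east steps at the r + 1 points where a path with
-- r returns meets the diagonal, so e(n,h) = Σ_r b(n,r+1) C(r+h,h); the sum
-- satisfies the same recurrence, and h = 0 gives the theorem.
module Submission where

open import Defs
open import Data.Empty using (⊥; ⊥-elim)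
open import Data.Fin.Base as Fin using (Fin; zero; suc; toℕ; fromℕ<)
open import Data.Fin.Patterns using (0F; 1F; 2F)
open import Data.Fin.Permutation using (Permutation′; _⟨$⟩ʳ_)
import Data.Fin.Properties as Fin
open import Data.List.Base using (List; []; _∷_; _++_; map; length; filter; applyUpTo)
open import Data.List.Membership.Propositional using (_∈_)
open import Data.List.Membership.Propositional.Properties using (∈-map⁺; ∈-map⁻;
  ∈-++⁺ˡ; ∈-++⁺ʳ; ∈-++⁻; ∈-map∘filter⁺; ∈-map∘filter⁻)
open import Data.List.Membership.Propositional.Properties.WithK using (unique∧set⇒bag)
open import Data.List.Properties using (length-map; length-++; map-∘)
open import Data.List.Relation.Binary.BagAndSetEquality using (∼bag⇒↭)
open import Data.List.Relation.Binary.Permutation.Propositional.Properties using (↭-length)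
open import Data.List.Relation.Unary.All using ([]; _∷_)
open import Data.List.Relation.Unary.AllPairs using ([]; _∷_)
import Data.List.Relation.Unary.AllPairs.Properties as AllPairs
open import Data.List.Relation.Unary.Any using (here)
open import Data.List.Relation.Unary.Unique.Propositional using (Unique)
import Data.List.Relation.Unary.Unique.Propositional.Properties as Unique
open import Data.Nat.Base
open import Data.Nat.ListAction using (sum)
open import Data.Nat.Properties
open import Data.Nat.Solver using (module +-*-Solver)
open import Data.Product.Base using (∃; ∃-syntax; _×_; _,_; proj₁; proj₂)
open import Data.Sum.Base using (_⊎_; inj₁; inj₂)
open import Data.Unit.Base using (⊤; tt)
open import Data.Vec.Base as Vec using (Vec; []; _∷_; lookup)
import Data.Vec.Properties as Vec
open import Function.Base using (_∘_)
open import Function.Bundles using (_⇔_; mk⇔; Equivalence; module Injection)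
open import Function.Definitions using (Injective)
open import Function.Properties.Inverse using (↔⇒↣)
open import Relation.Binary.Core using (_Preserves_⟶_)
open import Relation.Binary.Definitions using (Tri; tri<; tri≈; tri>)
open import Relation.Binary.PropositionalEquality
open import Relation.Nullary using (¬_; contradiction)

private
  variable
    m n x y h M : ℕ
    p : Path x y
    v : Vec ℕ y

-- Finite sums

∑ : ℕ → (ℕ → ℕ) → ℕ
∑ zero    f = 0
∑ (suc n) f = f 0 + ∑ n (f ∘ suc)

∑-cong : ∀ n {f g : ℕ → ℕ} → f ≗ g → ∑ n f ≡ ∑ n g
∑-cong zero    f≗g = refl
∑-cong (suc n) f≗g = cong₂ _+_ (f≗g 0) (∑-cong n (f≗g ∘ suc))

∑-+ : ∀ n (f g : ℕ → ℕ) → ∑ n (λ k → f k + g k) ≡ ∑ n f + ∑ n g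
∑-+ zero    f g = refl
∑-+ (suc n) f g rewrite ∑-+ n (f ∘ suc) (g ∘ suc) =
  solve 4 (λ a b c d → (a :+ b) :+ (c :+ d) := (a :+ c) :+ (b :+ d)) refl
    (f 0) (g 0) (∑ n (f ∘ suc)) (∑ n (g ∘ suc))
  where open +-*-Solver

∑-*ˡ : ∀ n a (f : ℕ → ℕ) → ∑ n (λ k → a * f k) ≡ a * ∑ n f
∑-*ˡ zero    a f = sym (*-zeroʳ a)
∑-*ˡ (suc n) a f rewrite ∑-*ˡ n a (f ∘ suc) = sym (*-distribˡ-+ a (f 0) _)

∑-suc : ∀ n (f : ℕ → ℕ) → ∑ (suc n) f ≡ ∑ n f + f n
∑-suc zero    f = +-identityʳ (f 0)
∑-suc (suc n) f = trans (cong (f 0 +_) (∑-suc n (f ∘ suc))) (sym (+-assoc (f 0) _ _))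

∑-applyUpTo : ∀ n (f g : ℕ → ℕ) → sum (map f (applyUpTo g n)) ≡ ∑ n (f ∘ g)
∑-applyUpTo zero    f g = refl
∑-applyUpTo (suc n) f g = cong (f (g 0) +_) (∑-applyUpTo n f (g ∘ suc))

-- Both sides add up `f k * g j` over the triangle `k ≤ j < n`, once by rows and once by columns.
-- The induction peels off the row `k = 0` and spreads its terms over the columns.
∑-triangle : ∀ n (f g : ℕ → ℕ) →
  ∑ (suc n) (λ k → f k * ∑ (n ∸ k) (λ i → g (k + i))) ≡
  ∑ n (λ j → g j * ∑ (suc j) f)
∑-triangle zero    f g = trans (+-identityʳ _) (*-zeroʳ (f 0))
∑-triangle (suc n) f g = begin
  f 0 * (g 0 + G) + ∑ (suc n) (λ k → f (suc k) * ∑ (n ∸ k) (λ i → g (suc k + i)))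
    ≡⟨ cong (f 0 * (g 0 + G) +_) (∑-triangle n (f ∘ suc) (g ∘ suc)) ⟩
  f 0 * (g 0 + G) + R
    ≡⟨ solve 4 (λ a b c d → a :* (b :+ c) :+ d := b :* (a :+ con 0) :+ (a :* c :+ d))
         refl (f 0) (g 0) G R ⟩
  g 0 * (f 0 + 0) + (f 0 * G + R)
    ≡⟨ cong (λ s → g 0 * (f 0 + 0) + (s + R)) (∑-*ˡ n (f 0) (g ∘ suc)) ⟨
  g 0 * (f 0 + 0) + (∑ n (λ j → f 0 * g (suc j)) + R)
    ≡⟨ cong (g 0 * (f 0 + 0) +_) (∑-+ n _ _) ⟨
  g 0 * (f 0 + 0) + ∑ n (λ j → f 0 * g (suc j) + g (suc j) * ∑ (suc j) (f ∘ suc))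
    ≡⟨ cong (g 0 * (f 0 + 0) +_) (∑-cong n λ j →
         solve 3 (λ a b c → a :* b :+ b :* c := b :* (a :+ c)) refl
           (f 0) (g (suc j)) (∑ (suc j) (f ∘ suc))) ⟩
  g 0 * (f 0 + 0) + ∑ n (λ j → g (suc j) * (f 0 + ∑ (suc j) (f ∘ suc))) ∎
  where
  open ≡-Reasoning
  open +-*-Solver
  G = ∑ n (g ∘ suc)
  R = ∑ n (λ j → g (suc j) * ∑ (suc j) (f ∘ suc))

-- Counting completions

mutual
  completions : ℕ → ℕ → ℕ
  completions zero    h       = 1
  completions (suc y) zero    = completionsN y zero
  completions (suc y) (suc h) = completions (suc y) h + completionsN y (suc h)

  completionsN : ℕ → ℕ → ℕ
  completionsN zero    h = completions zero h
  completionsN (suc y) h =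
    completions (suc y) h + (completions (suc y) h + completions y (suc h))

-- multichoose r h is C(r+h,h): the ways to place h indistinguishable
-- objects in r + 1 positions.
multichoose : ℕ → ℕ → ℕ
multichoose r zero    = 1
multichoose r (suc h) = ∑ (suc r) (λ k → multichoose k h)

multichoose-0 : ∀ h → multichoose 0 h ≡ 1
multichoose-0 zero    = refl
multichoose-0 (suc h) = trans (+-identityʳ _) (multichoose-0 h)

multichoose-pascal : ∀ r h →
  multichoose (suc r) (suc h) ≡ multichoose (suc r) h + multichoose r (suc h)
multichoose-pascal r h =
  trans (∑-suc (suc r) (λ k → multichoose k h)) (+-comm (multichoose r (suc h)) _)

-- The sum over the number of returns and its recurrence

returnSum : ℕ → ℕ → ℕ
returnSum n h = ∑ (suc n) (λ r → b n (suc r) * multichoose r h)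

b-suc : ∀ n k → b (3 + n) (2 + k) ≡
  2 * b (2 + n) (suc k) + ∑ (2 + n ∸ k) (λ i → b (suc n) (suc (k + i)))
b-suc n k = cong (2 * b (2 + n) (suc k) +_)
  (∑-applyUpTo (2 + n ∸ k) (b (suc n)) (suc k +_))

-- The doubled term of the recursion for `b` gives `returnSum (2 + n) h` twice. In the other term,
-- exchanging the summations leaves the inner sum of `multichoose k h` over `k ≤ j`, which is
-- `multichoose j (suc h)` by definition.
returnSum-shift : ∀ n h →
  ∑ (3 + n) (λ k → b (3 + n) (2 + k) * multichoose k h) ≡
  returnSum (2 + n) h + (returnSum (2 + n) h + returnSum (suc n) (suc h))
returnSum-shift n h = begin
  ∑ (3 + n) (λ k → b (3 + n) (2 + k) * mc k)
    ≡⟨ ∑-cong (3 + n) (λ k → trans (cong (_* mc k) (b-suc n k))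
         (solve 3 (λ a t m → (con 2 :* a :+ t) :* m := con 2 :* (a :* m) :+ m :* t)
           refl (b (2 + n) (suc k)) (tail k) (mc k))) ⟩
  ∑ (3 + n) (λ k → 2 * bmc k + mc k * tail k)
    ≡⟨ ∑-+ (3 + n) (λ k → 2 * bmc k) (λ k → mc k * tail k) ⟩
  ∑ (3 + n) (λ k → 2 * bmc k) + ∑ (3 + n) (λ k → mc k * tail k)
    ≡⟨ cong₂ _+_ (∑-*ˡ (3 + n) 2 bmc) (∑-triangle (2 + n) mc (b (suc n) ∘ suc)) ⟩
  2 * returnSum (2 + n) h + returnSum (suc n) (suc h)
    ≡⟨ solve 2 (λ a c → con 2 :* a :+ c := a :+ (a :+ c)) refl
         (returnSum (2 + n) h) (returnSum (suc n) (suc h)) ⟩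
  returnSum (2 + n) h + (returnSum (2 + n) h + returnSum (suc n) (suc h)) ∎
  where
  open ≡-Reasoning
  open +-*-Solver
  mc bmc tail : ℕ → ℕ
  mc k   = multichoose k h
  bmc k  = b (2 + n) (suc k) * mc k
  tail k = ∑ (2 + n ∸ k) (λ i → b (suc n) (suc (k + i)))

-- Pascal's rule asks whether one of the `suc h` extra east steps is inserted at the starting point.
-- If none is, a path with `k + 1` returns has only those `k + 1` places left, hence
-- `multichoose k (suc h)`. The term for `r = 0` carries over because `multichoose 0` is constantly
-- 1.
returnSum-pascal : ∀ n h → returnSum n (suc h) ≡
  returnSum n h + ∑ n (λ k → b n (2 + k) * multichoose k (suc h))
returnSum-pascal n h = begin
  b n 1 * multichoose 0 (suc h) + ∑ n (λ k → b n (2 + k) * multichoose (suc k) (suc h))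
    ≡⟨ cong₂ _+_ (cong (b n 1 *_) (trans (multichoose-0 (suc h)) (sym (multichoose-0 h))))
         (∑-cong n λ k → trans (cong (b n (2 + k) *_) (multichoose-pascal k h))
           (*-distribˡ-+ (b n (2 + k)) _ _)) ⟩
  b n 1 * multichoose 0 h +
  ∑ n (λ k → b n (2 + k) * multichoose (suc k) h + b n (2 + k) * multichoose k (suc h))
    ≡⟨ cong (b n 1 * multichoose 0 h +_)
         (∑-+ n (λ k → b n (2 + k) * multichoose (suc k) h) _) ⟩
  b n 1 * multichoose 0 h +
  (∑ n (λ k → b n (2 + k) * multichoose (suc k) h) + S)
    ≡⟨ +-assoc (b n 1 * multichoose 0 h) _ S ⟨
  returnSum n h + S ∎
  where
  open ≡-Reasoning
  S = ∑ n (λ k → b n (2 + k) * multichoose k (suc h))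

completions≡returnSum : ∀ n h → completions (suc n) h ≡ returnSum (suc n) h
-- Starting with a north step means that no extra east step is inserted at the starting point, so
-- only the `k + 1` returns can receive one.
completionsN≡ : ∀ n h → completionsN n h ≡
  ∑ (suc n) (λ k → b (suc n) (2 + k) * multichoose k h)

-- `b (suc n) 1` computes to 0, so the term `r = 0` of `returnSum` vanishes by computation.
completions≡returnSum n zero    = completionsN≡ n zero
completions≡returnSum n (suc h) = begin
  completions (suc n) h + completionsN n (suc h)
    ≡⟨ cong₂ _+_ (completions≡returnSum n h) (completionsN≡ n (suc h)) ⟩
  returnSum (suc n) h + ∑ (suc n) (λ k → b (suc n) (2 + k) * multichoose k (suc h))
    ≡⟨ returnSum-pascal (suc n) h ⟨
  returnSum (suc n) (suc h) ∎
  where open ≡-Reasoning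

completionsN≡ 0 h rewrite multichoose-0 h = refl
-- Here `completions 0 (suc h)` is 1, whereas `returnSum 0` would use the dummy values `b 0 k`,
-- which are 0. So this case is computed directly.
completionsN≡ 1 h
  rewrite completions≡returnSum 0 h | multichoose-0 h =
  solve 1 (λ m → m :+ con 0 :+ con 0 :+ (m :+ con 0 :+ con 0 :+ con 1) :=
                 con 1 :+ (m :+ (m :+ con 0) :+ con 0)) refl (multichoose 1 h)
  where open +-*-Solver
completionsN≡ (suc (suc n)) h = trans
  (cong₂ _+_ (completions≡returnSum (suc n) h)
    (cong₂ _+_ (completions≡returnSum (suc n) h) (completions≡returnSum n (suc h))))
  (sym (returnSum-shift n h))

-- Enumerating the avoiding parking functions

-- Completions of a path at height h (north minus east steps so far) whose
-- last step is not north, when the y unused labels are the numbers below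
-- y - 1 and one M ≥ y - 1.  L uses the largest label M, S the second
-- largest one, and SL is an ascent.
data Good : (h M : ℕ) → Path x y → Vec ℕ y → Set where
  []  : Good 0 M [] []
  E∷_ : Good h M p v → Good (suc h) M (E∷ p) v
  L∷_ : ∀ {p : Path x y} → Good h (pred y) p v → Good h M (N∷ E∷ p) (M ∷ v)
  S∷_ : ∀ {p : Path x (suc y)} → Good h M p v → Good h M (N∷ E∷ p) (y ∷ v)
  SL∷_ : ∀ {p : Path x y} → Good (suc h) (pred y) p v →
         Good h M (N∷ N∷ E∷ p) (y ∷ M ∷ v)

Word : ℕ → ℕ → Set
Word x y = Path x y × Vec ℕ y

consE : Word x y → Word (suc x) y
consE (p , v) = E∷ p , v

consNE : ℕ → Word x y → Word (suc x) (suc y)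
consNE a (p , v) = N∷ E∷ p , a ∷ v

consNNE : ℕ → ℕ → Word x y → Word (suc x) (2 + y)
consNNE a c (p , v) = N∷ N∷ E∷ p , a ∷ c ∷ v

mutual
  -- Every move contains exactly one east step, so recursion on the number `x` of east steps left
  -- follows the constructors of `Good`.
  words : ∀ x y → ℕ → ℕ → List (Word x y)
  words zero    zero    zero    M = ([] , []) ∷ []
  words zero    zero    (suc h) M = []
  words zero    (suc y) h       M = []
  words (suc x) y       h       M = wordsE x y h M ++ wordsN x y h M

  wordsE : ∀ x y → ℕ → ℕ → List (Word (suc x) y)
  wordsE x y zero    M = []
  wordsE x y (suc h) M = map consE (words x y h M)

  wordsN : ∀ x y → ℕ → ℕ → List (Word (suc x) y)
  wordsN x zero          h M = []
  wordsN x (suc zero)    h M = map (consNE M) (words x zero h 0)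
  wordsN x (suc (suc y)) h M =
    map (consNE M) (words x (suc y) h y) ++
    map (consNE y) (words x (suc y) h M) ++
    map (consNNE y M) (words x y (suc h) (pred y))

-- `x ≡ y + h` says that the path ends on the diagonal, so `completions` can leave out the east
-- steps. The value of `M` changes the words but not their number.
length-words : ∀ x y h M → x ≡ y + h → length (words x y h M) ≡ completions y h
length-wordsN : ∀ x y h M → x ≡ y + h → length (wordsN x (suc y) h M) ≡ completionsN y h

length-words zero zero zero M eq = refl
length-words (suc x) zero (suc h) M eq = begin
  length (map consE (words x 0 h M) ++ [])
    ≡⟨ length-++ (map consE (words x 0 h M)) ⟩
  length (map consE (words x 0 h M)) + 0
    ≡⟨ +-identityʳ _ ⟩
  length (map consE (words x 0 h M))
    ≡⟨ length-map consE (words x 0 h M) ⟩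
  length (words x 0 h M)
    ≡⟨ length-words x 0 h M (suc-injective eq) ⟩
  1 ∎
  where open ≡-Reasoning
length-words (suc x) (suc y) zero M eq = length-wordsN x y zero M (suc-injective eq)
length-words (suc x) (suc y) (suc h) M eq = trans
  (length-++ (map consE (words x (suc y) h M)))
  (cong₂ _+_
    (trans (length-map consE (words x (suc y) h M))
           (length-words x (suc y) h M (trans (suc-injective eq) (+-suc y h))))
    (length-wordsN x y (suc h) M (suc-injective eq)))

length-wordsN x zero h M eq =
  trans (length-map (consNE M) (words x 0 h 0)) (length-words x 0 h 0 eq)
length-wordsN x (suc y) h M eq = trans
  (length-++ (map (consNE M) (words x (suc y) h y)))
  (cong₂ _+_
    (trans (length-map (consNE M) (words x (suc y) h y)) (length-words x (suc y) h y eq))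
    (trans (length-++ (map (consNE y) (words x (suc y) h M)))
      (cong₂ _+_
        (trans (length-map (consNE y) (words x (suc y) h M)) (length-words x (suc y) h M eq))
        (trans (length-map (consNNE y M) (words x y (suc h) (pred y)))
          (length-words x y (suc h) (pred y) (trans eq (sym (+-suc y h))))))))

∈-words⁺ : Good h M p v → (p , v) ∈ words x y h M
∈-words⁺ {p = []}         []       = here refl
∈-words⁺ {p = E∷ _} (E∷ g)   = ∈-++⁺ˡ (∈-map⁺ consE (∈-words⁺ g))
∈-words⁺ {h = h} {M = M} {x = suc x} {y = suc zero} (L∷ g) =
  ∈-++⁺ʳ (wordsE x 1 h M) (∈-map⁺ (consNE M) (∈-words⁺ g))
∈-words⁺ {h = h} {M = M} {x = suc x} {y = suc (suc y)} (L∷ g) =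
  ∈-++⁺ʳ (wordsE x (2 + y) h M) (∈-++⁺ˡ (∈-map⁺ (consNE M) (∈-words⁺ g)))
∈-words⁺ {h = h} {M = M} {x = suc x} {y = suc (suc y)} (S∷ g) =
  ∈-++⁺ʳ (wordsE x (2 + y) h M) (∈-++⁺ʳ (map (consNE M) (words x (suc y) h y))
    (∈-++⁺ˡ (∈-map⁺ (consNE y) (∈-words⁺ g))))
∈-words⁺ {h = h} {M = M} {x = suc x} {y = suc (suc y)} (SL∷ g) =
  ∈-++⁺ʳ (wordsE x (2 + y) h M) (∈-++⁺ʳ (map (consNE M) (words x (suc y) h y))
    (∈-++⁺ʳ (map (consNE y) (words x (suc y) h M))
      (∈-map⁺ (consNNE y M) (∈-words⁺ g))))

∈-words⁻ : ∀ x y h M {w : Word x y} → w ∈ words x y h M → Good h M (proj₁ w) (proj₂ w)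
∈-wordsE⁻ : ∀ x y h M {w : Word (suc x) y} → w ∈ wordsE x y h M → Good h M (proj₁ w) (proj₂ w)
∈-wordsN⁻ : ∀ x y h M {w : Word (suc x) y} → w ∈ wordsN x y h M → Good h M (proj₁ w) (proj₂ w)

∈-words⁻ zero    zero    zero    M (here refl) = []
∈-words⁻ (suc x) y       h       M w∈ with ∈-++⁻ (wordsE x y h M) w∈
... | inj₁ w∈E = ∈-wordsE⁻ x y h M w∈E
... | inj₂ w∈N = ∈-wordsN⁻ x y h M w∈N

∈-wordsE⁻ x y (suc h) M w∈ with _ , u∈ , refl ← ∈-map⁻ consE w∈ =
  E∷ ∈-words⁻ x y h M u∈

∈-wordsN⁻ x (suc zero) h M w∈ with _ , u∈ , refl ← ∈-map⁻ (consNE M) w∈ =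
  L∷ ∈-words⁻ x 0 h 0 u∈
∈-wordsN⁻ x (suc (suc y)) h M w∈ with ∈-++⁻ (map (consNE M) (words x (suc y) h y)) w∈
... | inj₁ w∈L with _ , u∈ , refl ← ∈-map⁻ (consNE M) w∈L = L∷ ∈-words⁻ x (suc y) h y u∈
... | inj₂ w∈′ with ∈-++⁻ (map (consNE y) (words x (suc y) h M)) w∈′
...   | inj₁ w∈S with _ , u∈ , refl ← ∈-map⁻ (consNE y) w∈S = S∷ ∈-words⁻ x (suc y) h M u∈
...   | inj₂ w∈SL with _ , u∈ , refl ← ∈-map⁻ (consNNE y M) w∈SL =
  SL∷ ∈-words⁻ x y (suc h) (pred y) u∈

-- The moves `L` and `S` trace the same steps `N E` and are told apart only by their labels `M` and
-- `y`. With `2 + y` labels left, the bound `pred (2 + y) ≤ M` is literally `y < M`.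
words-unique : ∀ x y h M → pred y ≤ M → Unique (words x y h M)
wordsE-unique : ∀ x y h M → pred y ≤ M → Unique (wordsE x y h M)
wordsN-unique : ∀ x y h M → pred y ≤ M → Unique (wordsN x y h M)

words-unique zero    zero    zero    M _ = [] ∷ []
words-unique zero    zero    (suc h) M _ = []
words-unique zero    (suc y) h       M _ = []
words-unique (suc x) y       h       M y≤M = Unique.++⁺
  (wordsE-unique x y h M y≤M) (wordsN-unique x y h M y≤M)
  λ (w∈E , w∈N) → disjoint h y w∈E w∈N
  where
  disjoint : ∀ h y {w} → w ∈ wordsE x y h M → ¬ (w ∈ wordsN x y h M)
  disjoint (suc h) (suc zero) w∈E w∈N
    with _ , _ , refl ← ∈-map⁻ consE w∈E
    with _ , _ , () ← ∈-map⁻ (consNE M) w∈N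
  disjoint (suc h) (suc (suc y)) w∈E w∈N
    with _ , _ , refl ← ∈-map⁻ consE w∈E
    with ∈-++⁻ (map (consNE M) (words x (suc y) (suc h) y)) w∈N
  ... | inj₁ w∈L with _ , _ , () ← ∈-map⁻ (consNE M) w∈L
  ... | inj₂ w∈′ with ∈-++⁻ (map (consNE y) (words x (suc y) (suc h) M)) w∈′
  ...   | inj₁ w∈S with _ , _ , () ← ∈-map⁻ (consNE y) w∈S
  ...   | inj₂ w∈SL with _ , _ , () ← ∈-map⁻ (consNNE y M) w∈SL

wordsE-unique x y zero    M _   = []
wordsE-unique x y (suc h) M y≤M =
  Unique.map⁺ (λ { refl → refl }) (words-unique x y h M y≤M)

wordsN-unique x zero          h M _   = []
wordsN-unique x (suc zero)    h M _   =
  Unique.map⁺ (λ { refl → refl }) (words-unique x 0 h 0 z≤n)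
wordsN-unique x (suc (suc y)) h M y<M = Unique.++⁺
  (Unique.map⁺ (λ { refl → refl }) (words-unique x (suc y) h y ≤-refl))
  (Unique.++⁺
    (Unique.map⁺ (λ { refl → refl }) (words-unique x (suc y) h M (<⇒≤ y<M)))
    (Unique.map⁺ (λ { refl → refl }) (words-unique x y (suc h) (pred y) ≤-refl))
    λ (w∈S , w∈SL) → S#SL w∈S w∈SL)
  λ (w∈L , w∈′) → L#′ w∈L w∈′
  where
  S#SL : ∀ {w} → w ∈ map (consNE y) (words x (suc y) h M) →
         ¬ (w ∈ map (consNNE y M) (words x y (suc h) (pred y)))
  S#SL w∈S w∈SL
    with _ , _ , refl ← ∈-map⁻ (consNE y) w∈S
    with _ , _ , () ← ∈-map⁻ (consNNE y M) w∈SL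
  L#′ : ∀ {w} → w ∈ map (consNE M) (words x (suc y) h y) →
        ¬ (w ∈ map (consNE y) (words x (suc y) h M) ++
               map (consNNE y M) (words x y (suc h) (pred y)))
  L#′ w∈L w∈′ with _ , _ , refl ← ∈-map⁻ (consNE M) w∈L
    with ∈-++⁻ (map (consNE y) (words x (suc y) h M)) w∈′
  ... | inj₁ w∈S with _ , _ , refl ← ∈-map⁻ (consNE y) w∈S = <-irrefl refl y<M
  ... | inj₂ w∈SL with _ , _ , () ← ∈-map⁻ (consNNE y M) w∈SL

-- Labels avoiding 123 and 132

Remaining : (y M z : ℕ) → Set
Remaining zero    M z = ⊥
Remaining (suc m) M z = z < m ⊎ z ≡ M

-- The patterns 123 and 132 differ only in the order of the two larger entries, so avoiding both
-- means that no entry is exceeded by two later ones.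
Sparse : Vec ℕ y → Set
Sparse v = ∀ {i j k} → i Fin.< j → j Fin.< k →
  lookup v i < lookup v j → lookup v i < lookup v k → ⊥

-- The label set may have a gap below its largest element `M`; such gaps arise when second largest
-- labels are used before `M`.
record Admissible (M : ℕ) (v : Vec ℕ y) : Set where
  constructor admissible
  field
    injective : Injective _≡_ _≡_ (lookup v)
    range     : ∀ i → Remaining y M (lookup v i)
    onto      : ∀ z → Remaining y M z → ∃[ i ] lookup v i ≡ z
    sparse    : Sparse v
open Admissible

remaining-≤ : ∀ {z} → pred y ≤ M → Remaining y M z → z ≤ M
remaining-≤ {suc _} y≤M (inj₁ z<) = <⇒≤ (<-≤-trans z< y≤M)
remaining-≤ {suc _} y≤M (inj₂ refl) = ≤-refl

-- For `M` equal to `pred y` there is no gap: the labels are all numbers below `y`. This is the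
-- situation at the start and after each use of the largest label.
remaining-pred⇒< : ∀ {z} → Remaining y (pred y) z → z < y
remaining-pred⇒< {suc y} (inj₁ z<)   = m<n⇒m<1+n z<
remaining-pred⇒< {suc y} (inj₂ refl) = ≤-refl

<⇒remaining-pred : ∀ {z} → z < y → Remaining y (pred y) z
<⇒remaining-pred {suc y} (s≤s z≤y) with m≤n⇒m<n∨m≡n z≤y
... | inj₁ z<y = inj₁ z<y
... | inj₂ z≡y = inj₂ z≡y

head∉tail : ∀ {a} {v : Vec ℕ y} → Injective _≡_ _≡_ (lookup (a ∷ v)) →
            ∀ i → lookup v i ≢ a
head∉tail inj i eq with () ← inj {suc i} {zero} eq

∷-injective⁺ : ∀ {a} {v : Vec ℕ y} → (∀ i → lookup v i ≢ a) →
               Injective _≡_ _≡_ (lookup v) → Injective _≡_ _≡_ (lookup (a ∷ v))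
∷-injective⁺ a∉ inj {zero}  {zero}  eq = refl
∷-injective⁺ a∉ inj {zero}  {suc j} eq = contradiction (sym eq) (a∉ j)
∷-injective⁺ a∉ inj {suc i} {zero}  eq = contradiction eq (a∉ i)
∷-injective⁺ a∉ inj {suc i} {suc j} eq = cong suc (inj eq)

∷-sparse⁺ : ∀ {a} {v : Vec ℕ y} →
            (∀ {j k} → j Fin.< k → a < lookup v j → a < lookup v k → ⊥) →
            Sparse v → Sparse (a ∷ v)
∷-sparse⁺ a! v! {zero}  {suc j} {suc k} _       (s<s j<k) = a! j<k
∷-sparse⁺ a! v! {suc i} {suc j} {suc k} (s<s i<j) (s<s j<k) = v! i<j j<k

-- No later label exceeds `M`, so the new head cannot violate `Sparse`.
L⁺ : {v : Vec ℕ y} → y ≤ M → Admissible (pred y) v → Admissible M (M ∷ v)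
L⁺ {y} {M} {v} y≤M adm = admissible
  (∷-injective⁺ (λ i → <⇒≢ (v<M i)) (injective adm))
  (λ { zero → inj₂ refl ; (suc i) → inj₁ (v<y i) })
  (λ { z (inj₁ z<y) → let i , eq = onto adm z (<⇒remaining-pred z<y) in suc i , eq
     ; z (inj₂ refl) → zero , refl })
  (∷-sparse⁺ (λ {j} _ M< _ → <-asym M< (v<M j)) (sparse adm))
  where
  v<y : ∀ i → lookup v i < y
  v<y i = remaining-pred⇒< (range adm i)
  v<M : ∀ i → lookup v i < M
  v<M i = <-≤-trans (v<y i) y≤M

-- The only later label above `y` is `M`, and by injectivity it occurs only once.
S⁺ : {v : Vec ℕ (suc y)} → y < M → Admissible M v → Admissible M (y ∷ v)
S⁺ {y} {M} {v} y<M adm = admissible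
  (∷-injective⁺ y∉v (injective adm))
  (λ { zero → inj₁ ≤-refl ; (suc i) → weaken (range adm i) })
  onto′
  (∷-sparse⁺ (λ {j} {k} j<k y<j y<k →
      <⇒≢ j<k (cong toℕ (injective adm (trans (>⇒M y<j) (sym (>⇒M y<k))))))
    (sparse adm))
  where
  y∉v : ∀ i → lookup v i ≢ y
  y∉v i eq with range adm i
  ... | inj₁ v<y = <⇒≢ v<y eq
  ... | inj₂ v≡M = <⇒≢ y<M (trans (sym eq) v≡M)
  weaken : ∀ {z} → Remaining (suc y) M z → Remaining (2 + y) M z
  weaken (inj₁ z<y) = inj₁ (m<n⇒m<1+n z<y)
  weaken (inj₂ z≡M) = inj₂ z≡M
  onto′ : ∀ z → Remaining (2 + y) M z → ∃[ i ] lookup (y ∷ v) i ≡ z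
  onto′ z (inj₁ (s≤s z≤y)) with m≤n⇒m<n∨m≡n z≤y
  ... | inj₁ z<y = let i , eq = onto adm z (inj₁ z<y) in suc i , eq
  ... | inj₂ refl = zero , refl
  onto′ z (inj₂ z≡M) = let i , eq = onto adm z (inj₂ z≡M) in suc i , eq
  >⇒M : ∀ {j} → y < lookup v j → lookup v j ≡ M
  >⇒M {j} y<v with range adm j
  ... | inj₁ v<y = contradiction v<y (<-asym y<v)
  ... | inj₂ v≡M = v≡M

onto-tail : ∀ {a z} {v : Vec ℕ y} → ∃[ i ] lookup (a ∷ v) i ≡ z → z ≢ a → ∃[ i ] lookup v i ≡ z
onto-tail (zero  , a≡z) z≢a = contradiction (sym a≡z) z≢a
onto-tail (suc i , eq)  _   = i , eq

tail-injective : ∀ {a} {v : Vec ℕ y} → Injective _≡_ _≡_ (lookup (a ∷ v)) →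
                 Injective _≡_ _≡_ (lookup v)
tail-injective inj eq = Fin.suc-injective (inj eq)

tail-sparse : ∀ {a} {v : Vec ℕ y} → Sparse (a ∷ v) → Sparse v
tail-sparse sp i<j j<k = sp (s<s i<j) (s<s j<k)

L⁻ : {v : Vec ℕ y} → y ≤ M → Admissible M (M ∷ v) → Admissible (pred y) v
L⁻ {y} {M} {v} y≤M adm = admissible
  (tail-injective (injective adm))
  range′
  (λ z z∈ → let z<y = remaining-pred⇒< z∈ in
    onto-tail (onto adm z (inj₁ z<y)) (<⇒≢ (<-≤-trans z<y y≤M)))
  (tail-sparse (sparse adm))
  where
  range′ : ∀ i → Remaining y (pred y) (lookup v i)
  range′ i with range adm (suc i)
  ... | inj₁ v<y = <⇒remaining-pred v<y
  ... | inj₂ v≡M = contradiction v≡M (head∉tail (injective adm) i)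

S⁻ : {v : Vec ℕ (suc y)} → y < M → Admissible M (y ∷ v) → Admissible M v
S⁻ {y} {M} {v} y<M adm = admissible
  (tail-injective (injective adm))
  range′
  (λ { z (inj₁ z<y) → onto-tail (onto adm z (inj₁ (m<n⇒m<1+n z<y))) (<⇒≢ z<y)
     ; z (inj₂ z≡M) → onto-tail (onto adm z (inj₂ z≡M)) λ z≡y → <⇒≢ y<M (trans (sym z≡y) z≡M) })
  (tail-sparse (sparse adm))
  where
  range′ : ∀ i → Remaining (suc y) M (lookup v i)
  range′ i with range adm (suc i)
  ... | inj₂ v≡M = inj₂ v≡M
  ... | inj₁ (s≤s v≤y) with m≤n⇒m<n∨m≡n v≤y
  ...   | inj₁ v<y = inj₁ v<y
  ...   | inj₂ v≡y = contradiction v≡y (head∉tail (injective adm) i)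

-- Otherwise both M and the second largest remaining label would follow and exceed it.
head-admissible : ∀ {a} {v : Vec ℕ y} → y ≤ M → Admissible M (a ∷ v) →
                  a ≡ M ⊎ ∃[ m ] y ≡ suc m × a ≡ m
head-admissible {y} {M} {a} y≤M adm with range adm zero
... | inj₂ a≡M = inj₁ a≡M
... | inj₁ (s≤s {n = m} a≤m) with m≤n⇒m<n∨m≡n a≤m
...   | inj₂ a≡m = inj₂ (m , refl , a≡m)
...   | inj₁ a<m
  with j , vj≡m ← onto-tail (onto adm m (inj₁ ≤-refl)) (<⇒≢ a<m ∘ sym)
  with k , vk≡M ← onto-tail (onto adm M (inj₂ refl)) (<⇒≢ (<-trans a<m y≤M) ∘ sym)
  = ⊥-elim (conflict (Fin.<-cmp j k))
  where
  a<vj = subst (a <_) (sym vj≡m) a<m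
  a<vk = subst (a <_) (sym vk≡M) (<-trans a<m y≤M)
  conflict : Tri _ _ _ → ⊥
  conflict (tri< j<k _ _) = sparse adm {0F} {suc j} {suc k} z<s (s<s j<k) a<vj a<vk
  conflict (tri≈ _ refl _) = <⇒≢ y≤M (trans (sym vj≡m) vk≡M)
  conflict (tri> _ _ k<j) = sparse adm {0F} {suc k} {suc j} z<s (s<s k<j) a<vk a<vj

-- The bottom of an ascent is not the largest label, hence it is the second largest, and only `M`
-- exceeds that.
ascent-admissible : ∀ {a c} {v : Vec ℕ y} → y < M → a < c →
                    Admissible M (a ∷ c ∷ v) → a ≡ y × c ≡ M
ascent-admissible y<M a<c adm with head-admissible y<M adm
... | inj₁ a≡M = contradiction (<-≤-trans a<c (remaining-≤ y<M (range adm 1F))) (<-irrefl a≡M)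
... | inj₂ (_ , refl , refl) with range adm 1F
...   | inj₁ (s≤s c≤y) = contradiction a<c (≤⇒≯ c≤y)
...   | inj₂ c≡M       = refl , c≡M

-- Heights, and `Good` as the Dyck, labelling and avoidance conditions together

AboveDiagonal : ℕ → Path x y → Set
AboveDiagonal h       []     = ⊤
AboveDiagonal zero    (E∷ p) = ⊥
AboveDiagonal (suc h) (E∷ p) = AboveDiagonal h p
AboveDiagonal h       (N∷ p) = AboveDiagonal (suc h) p

neverBelow⇒≤ : ∀ i j (p : Path x y) → NeverBelow i j p → i ≤ j
neverBelow⇒≤ i j []     i≤j       = i≤j
neverBelow⇒≤ i j (E∷ p) (i≤j , _) = i≤j
neverBelow⇒≤ i j (N∷ p) (i≤j , _) = i≤j

-- The point `(i , h + i)` has height `h`, and the only way to fall below the diagonal is an east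
-- step at height 0.
neverBelow⇒above : ∀ i h (p : Path x y) → NeverBelow i (h + i) p → AboveDiagonal h p
neverBelow⇒above i h       []     _        = tt
neverBelow⇒above i zero    (E∷ p) (_ , nb) = <-irrefl refl (neverBelow⇒≤ (suc i) i p nb)
neverBelow⇒above i (suc h) (E∷ p) (_ , nb) =
  neverBelow⇒above (suc i) h p (subst (λ j → NeverBelow (suc i) j p) (sym (+-suc h i)) nb)
neverBelow⇒above i h       (N∷ p) (_ , nb) = neverBelow⇒above i (suc h) p nb

above⇒neverBelow : ∀ i h (p : Path x y) → AboveDiagonal h p → NeverBelow i (h + i) p
above⇒neverBelow i h       []     _  = m≤n+m i h
above⇒neverBelow i (suc h) (E∷ p) ab = m≤n+m i (suc h) ,
  subst (λ j → NeverBelow (suc i) j p) (+-suc h i) (above⇒neverBelow (suc i) h p ab)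
above⇒neverBelow i h       (N∷ p) ab = m≤n+m i h , above⇒neverBelow i (suc h) p ab

good⇒above : Good h M p v → AboveDiagonal h p
good⇒above []      = tt
good⇒above (E∷ g)  = good⇒above g
good⇒above (L∷ g)  = good⇒above g
good⇒above (S∷ g)  = good⇒above g
good⇒above (SL∷ g) = good⇒above g

good⇒admissible : {p : Path x y} → pred y ≤ M → Good h M p v → Admissible M v
good⇒admissible _   []      = admissible (λ { {()} }) (λ ()) (λ _ ()) (λ { {()} })
good⇒admissible y≤M (E∷ g)  = good⇒admissible y≤M g
good⇒admissible y≤M (L∷ g)  = L⁺ y≤M (good⇒admissible ≤-refl g)
good⇒admissible y<M (S∷ g)  = S⁺ y<M (good⇒admissible (<⇒≤ y<M) g)
-- As far as labels are concerned, an ascent is an `S` followed by an `L`.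
good⇒admissible y<M (SL∷ g) = S⁺ y<M (L⁺ (<⇒≤ y<M) (good⇒admissible ≤-refl g))

good⇒increasing : (p : Path x y) (v : Vec (Fin n) y) → pred y ≤ M →
                  Good h M p (Vec.map toℕ v) → Increasing p v
good⇒increasing []               _           _   _       = tt
good⇒increasing (E∷ p)           v           y≤M (E∷ g)  = good⇒increasing p v y≤M g
good⇒increasing (N∷ [])          _           _   _       = tt
good⇒increasing (N∷ E∷ p)        (a ∷ v)     y≤M (L∷ g)  = good⇒increasing p v ≤-refl g
good⇒increasing (N∷ E∷ p)        (a ∷ v)     y<M (S∷ g)  = good⇒increasing p v (<⇒≤ y<M) g
-- The two labels are `y` and `M`, so the bound on `M` is itself the required inequality.
good⇒increasing (N∷ N∷ E∷ p)     (a ∷ c ∷ v) y<M (SL∷ g) = y<M , good⇒increasing p v ≤-refl g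

-- The cases follow the initial run of north steps. `x ≡ y + h` makes the final height 0 and rules
-- out the paths `N` and `N N`, which would end without an east step.
admissible⇒good : (p : Path x y) (v : Vec (Fin n) y) → x ≡ y + h → pred y ≤ M →
  AboveDiagonal h p → Increasing p v → Admissible M (Vec.map toℕ v) → Good h M p (Vec.map toℕ v)
admissible⇒good []      [] refl y≤M ab inc adm = []
admissible⇒good {y = y} {h = suc h} (E∷ p) v eq y≤M ab inc adm =
  E∷ admissible⇒good p v (suc-injective (trans eq (+-suc y h))) y≤M ab inc adm
admissible⇒good (N∷ E∷ p) (a ∷ v) eq y≤M ab inc adm with head-admissible y≤M adm
... | inj₁ refl = L∷ admissible⇒good p v (suc-injective eq) ≤-refl ab inc (L⁻ y≤M adm)
... | inj₂ (_ , refl , refl) =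
  S∷ admissible⇒good p v (suc-injective eq) (<⇒≤ y≤M) ab inc (S⁻ y≤M adm)
admissible⇒good {h = h} {M = M} (N∷ N∷ E∷ p) (a ∷ c ∷ v) eq y<M ab (a<c , inc) adm
  with a≡y , c≡M ← ascent-admissible y<M a<c adm =
  subst₂ (λ a c → Good h M (N∷ N∷ E∷ p) (a ∷ c ∷ Vec.map toℕ v)) (sym a≡y) (sym c≡M)
    (SL∷ admissible⇒good p v (trans (suc-injective eq) (sym (+-suc _ h))) ≤-refl ab inc
      (L⁻ (<⇒≤ y<M) (S⁻ y<M
        (subst₂ (λ a c → Admissible M (a ∷ c ∷ Vec.map toℕ v)) a≡y c≡M adm))))
-- A third consecutive north step would need a label above `M`.
admissible⇒good (N∷ N∷ N∷ p) (a ∷ c ∷ d ∷ v) eq y<M ab (a<c , c<d , inc) adm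
  with _ , c≡M ← ascent-admissible y<M a<c adm =
  contradiction c<d (≤⇒≯ (subst (toℕ d ≤_) (sym c≡M) (remaining-≤ y<M (range adm 2F))))

-- Parking functions and their enumeration

map-injective : ∀ {A B : Set} {f : A → B} → Injective _≡_ _≡_ f →
                Injective _≡_ _≡_ (Vec.map {n = n} f)
map-injective inj {[]}    {[]}    eq = refl
map-injective inj {_ ∷ _} {_ ∷ _} eq =
  cong₂ _∷_ (inj (Vec.∷-injectiveˡ eq)) (map-injective inj (Vec.∷-injectiveʳ eq))

map-toℕ-surjective : (v : Vec ℕ y) → (∀ i → lookup v i < n) → ∃[ u ] v ≡ Vec.map {n = y} (toℕ {n}) u
map-toℕ-surjective []      _   = [] , refl
map-toℕ-surjective (a ∷ v) v<n with u , refl ← map-toℕ-surjective v (v<n ∘ suc) =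
  fromℕ< (v<n zero) ∷ u , cong (_∷ _) (sym (Fin.toℕ-fromℕ< (v<n zero)))

-- Pattern occurrences and `Sparse`

module _ (π : Permutation′ n) (ρ : Permutation′ m) {f : Fin m → Fin n}
         (f-mono : f Preserves Fin._<_ ⟶ Fin._<_)
         (iso : ∀ a b → ρ ⟨$⟩ʳ a Fin.< ρ ⟨$⟩ʳ b → π ⟨$⟩ʳ f a Fin.< π ⟨$⟩ʳ f b) where

  -- Preserving the strict inequalities of `ρ` suffices: the order is total, and equal values of `ρ`
  -- come from equal positions.
  occurrence : IsOccurrence π ρ f
  occurrence = f-mono , λ a b → mk⇔ (reflect a b) (preserve a b)
    where
    preserve : ∀ a b → ρ ⟨$⟩ʳ a Fin.≤ ρ ⟨$⟩ʳ b → π ⟨$⟩ʳ f a Fin.≤ π ⟨$⟩ʳ f b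
    preserve a b a≤b with m≤n⇒m<n∨m≡n a≤b
    ... | inj₁ a<b = <⇒≤ (iso a b a<b)
    ... | inj₂ a≡b = ≤-reflexive (cong (toℕ ∘ (π ⟨$⟩ʳ_) ∘ f)
                       (Injection.injective (↔⇒↣ ρ) (Fin.toℕ-injective a≡b)))
    reflect : ∀ a b → π ⟨$⟩ʳ f a Fin.≤ π ⟨$⟩ʳ f b → ρ ⟨$⟩ʳ a Fin.≤ ρ ⟨$⟩ʳ b
    reflect a b fa≤fb = ≮⇒≥ λ b<a → <⇒≱ (iso b a b<a) fa≤fb

occurrence-< : (π : Permutation′ n) (ρ : Permutation′ m) {f : Fin m → Fin n} →
  IsOccurrence π ρ f → ∀ a b → ρ ⟨$⟩ʳ a Fin.< ρ ⟨$⟩ʳ b → π ⟨$⟩ʳ f a Fin.< π ⟨$⟩ʳ f b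
occurrence-< π ρ (_ , iso) a b a<b =
  ≰⇒> λ fb≤fa → <⇒≱ a<b (Equivalence.to (iso b a) fb≤fa)

triple-mono : {i j k : Fin n} → i Fin.< j → j Fin.< k →
              lookup (i ∷ j ∷ k ∷ []) Preserves Fin._<_ ⟶ Fin._<_
triple-mono i<j j<k {0F} {1F} _ = i<j
triple-mono i<j j<k {0F} {2F} _ = <-trans i<j j<k
triple-mono i<j j<k {1F} {2F} _ = j<k
triple-mono i<j j<k {1F} {1F} (s≤s ())
triple-mono i<j j<k {2F} {1F} (s≤s ())
triple-mono i<j j<k {2F} {2F} (s≤s (s≤s ()))

module _ (ls : Vec (Fin n) n) (bij : IsBijective ls) where
  private
    π = toPermutation ls bij
    labels = Vec.map toℕ ls

  lookup-labels : ∀ i → lookup labels i ≡ toℕ (π ⟨$⟩ʳ i)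
  lookup-labels i = Vec.lookup-map i toℕ ls

  private
    labels-< : ∀ {i j} → π ⟨$⟩ʳ i Fin.< π ⟨$⟩ʳ j → lookup labels i < lookup labels j
    labels-< {i} {j} = subst₂ _<_ (sym (lookup-labels i)) (sym (lookup-labels j))
    π-< : ∀ {i j} → lookup labels i < lookup labels j → π ⟨$⟩ʳ i Fin.< π ⟨$⟩ʳ j
    π-< {i} {j} = subst₂ _<_ (lookup-labels i) (lookup-labels j)

  sparse⇒avoids : Sparse labels → AvoidsAll π (123ₚ ∷ 132ₚ ∷ [])
  sparse⇒avoids sp =
    (λ (f , occ) → sp (proj₁ occ {0F} {1F} z<s) (proj₁ occ {1F} {2F} (s<s z<s))
      (labels-< (occurrence-< π (proj₂ 123ₚ) occ 0F 1F z<s))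
      (labels-< (occurrence-< π (proj₂ 123ₚ) occ 0F 2F z<s))) ∷
    (λ (f , occ) → sp (proj₁ occ {0F} {1F} z<s) (proj₁ occ {1F} {2F} (s<s z<s))
      (labels-< (occurrence-< π (proj₂ 132ₚ) occ 0F 1F z<s))
      (labels-< (occurrence-< π (proj₂ 132ₚ) occ 0F 2F z<s))) ∷ []

  -- The order of the two larger entries decides which pattern occurs; they are distinct because `π`
  -- is injective.
  avoids⇒sparse : AvoidsAll π (123ₚ ∷ 132ₚ ∷ []) → Sparse labels
  avoids⇒sparse (¬123 ∷ ¬132 ∷ []) {i} {j} {k} i<j j<k li<lj li<lk =
    conflict (Fin.<-cmp (π ⟨$⟩ʳ j) (π ⟨$⟩ʳ k))
    where
    i<j′ = π-< li<lj
    i<k′ = π-< li<lk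
    conflict : Tri _ _ _ → ⊥
    conflict (tri< j<k′ _ _) = ¬123 (_ , occurrence π (proj₂ 123ₚ) (triple-mono i<j j<k) λ
      { 0F 1F _ → i<j′
      ; 0F 2F _ → i<k′
      ; 1F 2F _ → j<k′
      ; 1F 1F (s≤s ())
      ; 2F 1F (s≤s ())
      ; 2F 2F (s≤s (s≤s ()))
      })
    conflict (tri≈ _ j≡k _) = <⇒≢ j<k (cong toℕ (proj₁ bij j≡k))
    conflict (tri> _ _ k<j′) = ¬132 (_ , occurrence π (proj₂ 132ₚ) (triple-mono i<j j<k) λ
      { 0F 1F _ → i<j′
      ; 0F 2F _ → i<k′
      ; 2F 1F _ → k<j′
      ; 1F 1F (s≤s (s≤s ()))
      ; 1F 2F (s≤s ())
      ; 2F 2F (s≤s ())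
      })

  sparse⇒admissible : Sparse labels → Admissible (pred n) labels
  sparse⇒admissible sp = admissible
    (λ {i} {j} eq → proj₁ bij (Fin.toℕ-injective
      (trans (sym (lookup-labels i)) (trans eq (lookup-labels j)))))
    (λ i → <⇒remaining-pred (subst (_< n) (sym (lookup-labels i)) (Fin.toℕ<n _)))
    (λ z z∈ → let z<n = remaining-pred⇒< z∈
                  i , eq = proj₂ bij (fromℕ< z<n)
              in i , trans (lookup-labels i) (trans (cong toℕ (eq refl)) (Fin.toℕ-fromℕ< z<n)))
    sp

admissible⇒bijective : {ls : Vec (Fin n) n} → Admissible (pred n) (Vec.map toℕ ls) → IsBijective ls
admissible⇒bijective {n} {ls} adm =
  (λ {i} {j} eq → injective adm (trans (Vec.lookup-map i toℕ ls)
    (trans (cong toℕ eq) (sym (Vec.lookup-map j toℕ ls))))) ,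
  λ a → let i , eq = onto adm (toℕ a) (<⇒remaining-pred (Fin.toℕ<n a)) in
    i , λ { refl → Fin.toℕ-injective (trans (sym (Vec.lookup-map i toℕ ls)) eq) }

-- Comparison of the two enumerations

word : ParkingFunction n → Word n n
word ((p , ls) , _) = p , Vec.map toℕ ls

avoids⇒good : (q : ParkingFunction n) → AvoidsAll (φ q) (123ₚ ∷ 132ₚ ∷ []) →
              Good 0 (pred n) (proj₁ (word q)) (proj₂ (word q))
avoids⇒good {n} ((p , ls) , isParkingFunction dyck bij inc) av =
  admissible⇒good p ls (sym (+-identityʳ n)) ≤-refl (neverBelow⇒above 0 0 p dyck) inc
    (sparse⇒admissible ls bij (avoids⇒sparse ls bij av))

good⇒avoids : (q : ParkingFunction n) → Good 0 (pred n) (proj₁ (word q)) (proj₂ (word q)) →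
              AvoidsAll (φ q) (123ₚ ∷ 132ₚ ∷ [])
good⇒avoids ((p , ls) , isPF) g =
  sparse⇒avoids ls (IsParkingFunction.bijective isPF) (sparse (good⇒admissible ≤-refl g))

good⇒parking : (p : Path n n) (v : Vec ℕ n) → Good 0 (pred n) p v →
               ∃[ q ] (p , v) ≡ word {n} q
good⇒parking p v g
  with adm ← good⇒admissible ≤-refl g
  with ls , refl ← map-toℕ-surjective v (λ i → remaining-pred⇒< (range adm i)) =
  ((p , ls) , isParkingFunction (above⇒neverBelow 0 0 p (good⇒above g))
    (admissible⇒bijective adm) (good⇒increasing p ls ≤-refl g)) , refl

module _ n (ρs : List (∃ Permutation′))
         (avoids⇔good : (q : ParkingFunction n) →
            AvoidsAll (φ q) ρs ⇔ Good 0 (pred n) (proj₁ (word q)) (proj₂ (word q))) where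

  private
    P? = λ (q : ParkingFunction n) → avoidsAll? (φ q) ρs
    avoiders = filter P? (parkingFunctions n)

    unique : Unique (map word avoiders)
    -- Distinctness is known for the underlying labelled paths, so `word` is factored through
    -- `proj₁`.
    unique = subst Unique (sym (map-∘ avoiders))
      (Unique.map⁺ {f = λ (p , ls) → p , Vec.map toℕ ls}
        (λ eq → cong₂ _,_ (cong proj₁ eq) (map-injective Fin.toℕ-injective (cong proj₂ eq)))
        (AllPairs.map⁺ (AllPairs.filter⁺ P? (AllPairs.map⁻ (parkingFunctions-unique n)))))

    to : ∀ {w} → w ∈ map word avoiders → w ∈ words n n 0 (pred n)
    to w∈ with q , _ , refl , av ← ∈-map∘filter⁻ word P? {xs = parkingFunctions n} w∈ =
      ∈-words⁺ (Equivalence.to (avoids⇔good q) av)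

    from : ∀ {w} → w ∈ words n n 0 (pred n) → w ∈ map word avoiders
    from {p , v} w∈ with g ← ∈-words⁻ n n 0 (pred n) w∈
      with q , refl ← good⇒parking p v g
      -- The list contains some `q′` with the labelled path of `q` but possibly other proofs. `word`
      -- ignores the proofs, so `g` applies to `q′` as well.
      with q′ , q′∈ , refl ← ∈-map⁻ proj₁ (parkingFunctions-complete q) =
      ∈-map∘filter⁺ word P? {xs = parkingFunctions n}
        (q′ , q′∈ , refl , Equivalence.from (avoids⇔good q′) g)

  -- Two lists without repetitions and with the same members are permutations of each other. The
  -- patterns enter only through `avoids⇔good`.
  pf≡completions : pf n ρs ≡ completions n 0
  pf≡completions = begin
    length avoiders                ≡⟨ length-map word avoiders ⟨
    length (map word avoiders)     ≡⟨ ↭-length (∼bag⇒↭ (unique∧set⇒bag unique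
                                        (words-unique n n 0 (pred n) ≤-refl) (mk⇔ to from))) ⟩
    length (words n n 0 (pred n))  ≡⟨ length-words n n 0 (pred n) (sym (+-identityʳ n)) ⟩
    completions n 0                ∎
    where open ≡-Reasoning

theorem20 : ∀ (n : ℕ) → n ≥ 1 →
    pf n (123ₚ ∷ 132ₚ ∷ []) ≡ sumFromTo 2 (n + 1) (b n)
theorem20 (suc n) _ = begin
  pf (suc n) (123ₚ ∷ 132ₚ ∷ [])
    ≡⟨ pf≡completions (suc n) (123ₚ ∷ 132ₚ ∷ [])
         (λ q → mk⇔ (avoids⇒good q) (good⇒avoids q)) ⟩
  completions (suc n) 0
    ≡⟨ completions≡returnSum n 0 ⟩
  ∑ (suc n) (λ k → b (suc n) (2 + k) * 1)
    ≡⟨ ∑-cong (suc n) (λ k → *-identityʳ (b (suc n) (2 + k))) ⟩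
  ∑ (suc n) (λ k → b (suc n) (2 + k))
    -- The number of terms in `sumFromTo 2 (suc n + 1)` computes to `n + 1`, not to `suc n`.
    ≡⟨ cong (λ l → ∑ l (λ k → b (suc n) (2 + k))) (+-comm n 1) ⟨
  ∑ (n + 1) (λ k → b (suc n) (2 + k))
    ≡⟨ ∑-applyUpTo (n + 1) (b (suc n)) (2 +_) ⟨
  sumFromTo 2 (suc n + 1) (b (suc n)) ∎
  where open ≡-Reasoning
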